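{- Let $k_1\ge k_2\ge 2$ be integers. Then every digraph $D$ with $\delta^+(D)\ge k_1+3k_2-5$ contains a subdivision of $C(k_1,k_2)$; that is, $\mathrm{mader}_{\delta^+}(C(k_1,k_2))\le k_1+3k_2-5$.
   Context: Digraphs are finite, loopless, without parallel arcs, but may contain digons. $\delta^+(D)$ is the minimum out-degree. For integers $k_1,k_2\ge1$, $C(k_1,k_2)$ is the oriented cycle consisting of two vertices $x,y$ and two internally vertex-disjoint directed paths from $x$ to $y$ of lengths $k_1$ and $k_2$. A subdivision of a digraph $F$ is obtained by replacing each arc $(u,v)$ by a directed $u$-$v$ path, paths for different arcs being internally vertex-disjoint. $\mathrm{mader}_{\delta^+}(F)$ denotes the smallest integer $m$ such that every digraph of minimum out-degree at least $m$ contains a subdivision of $F$. (Equivalently: $D$ contains two internally vertex-disjoint directed paths with common start and common end vertex, of lengths at least $k_1$ and at least $k_2$.) -}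

module Defs where

open import Data.Nat using (ℕ; zero; suc; _≤_)
open import Data.Fin using (Fin; zero; suc; inject₁; fromℕ)
open import Data.Fin.Subset using (∣_∣)
open import Data.Vec using (tabulate)
open import Data.Bool using (Bool; true; false)
open import Data.Product using (Σ; _×_; ∃-syntax)
open import Data.Sum using (_⊎_)
open import Function.Definitions using (Injective)
open import Relation.Binary.PropositionalEquality using (_≡_)

-- A digraph on vertex set Fin n: adjacency matrix (arc u → v iff adj u v ≡ true).
-- Loopless; no parallel arcs (a relation); digons allowed (adj u v and adj v u).
record Digraph (n : ℕ) : Set where
  field
    adj      : Fin n → Fin n → Bool
    loopless : ∀ v → adj v v ≡ false
open Digraph public

outdeg : ∀ {n} → Digraph n → Fin n → ℕ
outdeg D v = ∣ tabulate (adj D v) ∣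

MinOutDegAtLeast : ∀ {n} → Digraph n → ℕ → Set
MinOutDegAtLeast D m = ∀ v → m ≤ outdeg D v

record DiPath {n : ℕ} (D : Digraph n) (x y : Fin n) (ℓ : ℕ) : Set where
  field
    vtx   : Fin (suc ℓ) → Fin n
    inj   : Injective _≡_ _≡_ vtx
    start : vtx zero ≡ x
    end   : vtx (fromℕ ℓ) ≡ y
    arcs  : ∀ (i : Fin ℓ) → adj D (vtx (inject₁ i)) (vtx (suc i)) ≡ true
open DiPath public

HasSubdivisionC : ∀ {n} → Digraph n → ℕ → ℕ → Set
HasSubdivisionC {n} D k₁ k₂ =
  Σ (Fin n) λ x → Σ (Fin n) λ y →
  ∃[ ℓ₁ ] ∃[ ℓ₂ ] (k₁ ≤ ℓ₁ × k₂ ≤ ℓ₂ ×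
    Σ (DiPath D x y ℓ₁) λ P → Σ (DiPath D x y ℓ₂) λ Q →
      (∀ i j → vtx P i ≡ vtx Q j → (vtx P i ≡ x ⊎ vtx P i ≡ y)))

{-# OPTIONS --safe #-}
-- Consider paths P and sets E with |E| ≤ k₂ - 1 such that every out-neighbour of the end u of P
-- lies in E or on P; choose such a pair for which the first out-neighbour of u on P has the
-- largest possible index i and, subject to that, P is as short as possible.  Let Z be the last
-- k₂ - 1 vertices of P (the last one is u) and x the vertex before them.  The initial segment of P
-- up to x, extended greedily by R in D - Z to an end z, is again such a path (with E = Z), so z has
-- an out-neighbour y on P of index at most i, and y has index less than i unless R is nonempty.
-- Let α be the last out-neighbour of u before x.  The paths x Z α, of length k₂, and x R z y … α
-- are internally disjoint, and the second one has length at least k₁, because at most 2k₂ - 2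
-- out-neighbours of u lie outside the segment of P from index i to α.
module Submission where

open import Defs
open import Data.Nat using (ℕ; _≤_; _<_; _+_; _*_; _∸_)
open import Data.Nat using (zero; suc; z≤n; s≤s)
open import Data.Nat.Properties hiding (_≟_)
open import Data.Nat.Tactic.RingSolver using (solve-∀)
open import Data.Bool using (true)
import Data.Bool.Properties as Bool
open import Data.Empty using (⊥-elim)
open import Data.Fin using (Fin; zero; suc; inject₁; fromℕ; opposite)
open import Data.Fin.Properties using (_≟_; any?; injective⇒≤; opposite-involutive)
open import Data.Fin.Subset using (Subset; inside; outside; ∣_∣; _∪_; ⁅_⁆; ⋃)
open import Data.Fin.Subset.Properties using (p⊆q⇒∣p∣≤∣q∣; ∣⊥∣≡0; ∣⁅x⁆∣≡1; x∈⁅x⁆; x∈p∪q⁺)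
open import Data.List using (List; []; _∷_; _++_; [_]; length; lookup; map)
open import Data.List.Properties using (++-assoc; ++-identityʳ; length-++; length-++-≤ʳ)
open import Data.List.Membership.Propositional using (_∈_; _∉_)
open import Data.List.Membership.Propositional.Properties using (∈-lookup; ∈-++⁺ˡ; ∈-++⁺ʳ; ∈-++⁻)
open import Data.List.Relation.Binary.Disjoint.Propositional using (Disjoint)
open import Data.List.Relation.Unary.All using (All; []; _∷_)
import Data.List.Relation.Unary.All as All
import Data.List.Relation.Unary.All.Properties as All
open import Data.List.Relation.Unary.AllPairs using ([]; _∷_)
open import Data.List.Relation.Unary.Any using (here; there)
open import Data.List.Relation.Unary.Linked using (Linked; []; [-]; _∷_)
import Data.List.Relation.Unary.Linked as Linked
open import Data.List.Relation.Unary.Unique.Propositional using (Unique)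
open import Data.Product using (∃-syntax; _×_; _,_; proj₁; proj₂)
open import Data.Sum using (_⊎_; inj₁; inj₂)
open import Data.Vec using ([]; _∷_; tabulate)
import Data.Vec.Properties as Vec
open import Function using (_∘_)
open import Function.Definitions using (Injective)
open import Relation.Nullary using (¬_; Dec; yes; no; contradiction; ¬?; _×-dec_; decidable-stable)
open import Relation.Binary.PropositionalEquality using (_≡_; refl; sym; trans; cong; subst)

-- Lists without repetition, cardinalities of subsets, reversal of indices.

private
  variable
    A : Set

headOr : A → List A → A
headOr x []      = x
headOr x (y ∷ _) = y

lastOr : A → List A → A
lastOr x []       = x
lastOr x (y ∷ ys) = lastOr y ys

lastOr-++ : (x y : A) (xs : List A) → lastOr x (xs ++ [ y ]) ≡ y
lastOr-++ x y []       = refl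
lastOr-++ x y (z ∷ zs) = lastOr-++ z y zs

init-last : (x : A) (xs : List A) → ∃[ ys ] x ∷ xs ≡ ys ++ [ lastOr x xs ]
init-last x []       = [] , refl
init-last x (y ∷ ys) = let zs , eq = init-last y ys in x ∷ zs , cong (x ∷_) eq

lookup-last : (x : A) (xs : List A) → lookup (x ∷ xs) (fromℕ (length xs)) ≡ lastOr x xs
lookup-last x []       = refl
lookup-last x (y ∷ ys) = lookup-last y ys

lookup-injective : {xs : List A} → Unique xs → Injective _≡_ _≡_ (lookup xs)
lookup-injective (_ ∷ _)  {zero}  {zero}  _  = refl
lookup-injective (p ∷ _)  {zero}  {suc j} eq = contradiction eq (All.lookup p (∈-lookup j))
lookup-injective (p ∷ _)  {suc i} {zero}  eq = contradiction (sym eq) (All.lookup p (∈-lookup i))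
lookup-injective (_ ∷ xs!) {suc i} {suc j} eq = cong suc (lookup-injective xs! eq)

Unique-++⁻ : (xs : List A) {ys : List A} → Unique (xs ++ ys) →
             Unique xs × Unique ys × Disjoint xs ys
Unique-++⁻ []       ys!       = [] , ys! , λ ()
Unique-++⁻ (x ∷ xs) (p ∷ xys!) =
  let xs! , ys! , xs#ys = Unique-++⁻ xs xys! in
  All.++⁻ˡ xs p ∷ xs! , ys! ,
  λ { (here refl , v∈ys) → All.lookup (All.++⁻ʳ xs p) v∈ys refl
    ; (there v∈xs , v∈ys) → xs#ys (v∈xs , v∈ys) }

Linked-++⁻ : {R : A → A → Set} (xs : List A) {ys : List A} → Linked R (xs ++ ys) →
             Linked R xs × Linked R ys
Linked-++⁻ []           ls       = [] , ls
Linked-++⁻ (x ∷ [])     ls       = [-] , Linked.tail ls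
Linked-++⁻ (x ∷ y ∷ xs) (l ∷ ls) =
  let ls₁ , ls₂ = Linked-++⁻ (y ∷ xs) ls in l ∷ ls₁ , ls₂

splitAt-< : ∀ m (xs : List A) → m < length xs →
            ∃[ ys ] ∃[ z ] ∃[ zs ] (xs ≡ ys ++ z ∷ zs × length ys ≡ m)
splitAt-< zero    (x ∷ xs) _       = [] , x , xs , refl , refl
splitAt-< (suc m) (x ∷ xs) (s≤s p) =
  let ys , z , zs , eq , len = splitAt-< m xs p in
  x ∷ ys , z , zs , cong (x ∷_) eq , cong suc len

splitFirst : {P : A → Set} → (∀ x → Dec (P x)) → (xs : List A) →
             (∃[ ys ] ∃[ z ] ∃[ zs ] (xs ≡ ys ++ z ∷ zs × All (¬_ ∘ P) ys × P z)) ⊎ All (¬_ ∘ P) xs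
splitFirst P? []       = inj₂ []
splitFirst P? (x ∷ xs) with P? x
... | yes px = inj₁ ([] , x , xs , refl , [] , px)
... | no ¬px with splitFirst P? xs
...   | inj₁ (ys , z , zs , refl , ¬ps , pz) = inj₁ (x ∷ ys , z , zs , refl , ¬px ∷ ¬ps , pz)
...   | inj₂ ¬ps                             = inj₂ (¬px ∷ ¬ps)

∣p∪q∣≤∣p∣+∣q∣ : ∀ {n} (p q : Subset n) → ∣ p ∪ q ∣ ≤ ∣ p ∣ + ∣ q ∣
∣p∪q∣≤∣p∣+∣q∣ []            []            = z≤n
∣p∪q∣≤∣p∣+∣q∣ (outside ∷ p) (outside ∷ q) = ∣p∪q∣≤∣p∣+∣q∣ p q
∣p∪q∣≤∣p∣+∣q∣ (outside ∷ p) (inside ∷ q)  =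
  ≤-trans (s≤s (∣p∪q∣≤∣p∣+∣q∣ p q)) (≤-reflexive (sym (+-suc ∣ p ∣ ∣ q ∣)))
∣p∪q∣≤∣p∣+∣q∣ (inside ∷ p)  (outside ∷ q) = s≤s (∣p∪q∣≤∣p∣+∣q∣ p q)
∣p∪q∣≤∣p∣+∣q∣ (inside ∷ p)  (inside ∷ q)  =
  s≤s (≤-trans (∣p∪q∣≤∣p∣+∣q∣ p q) (+-monoʳ-≤ ∣ p ∣ (n≤1+n ∣ q ∣)))

∣⋃⁅xs⁆∣≤length : ∀ {n} (xs : List (Fin n)) → ∣ ⋃ (map ⁅_⁆ xs) ∣ ≤ length xs
∣⋃⁅xs⁆∣≤length {n} []       = ≤-reflexive (∣⊥∣≡0 n)
∣⋃⁅xs⁆∣≤length     (x ∷ xs) = ≤-trans (∣p∪q∣≤∣p∣+∣q∣ ⁅ x ⁆ _)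
  (+-mono-≤ (≤-reflexive (∣⁅x⁆∣≡1 x)) (∣⋃⁅xs⁆∣≤length xs))

∈⇒∈⋃⁅xs⁆ : ∀ {n} {v : Fin n} {xs} → v ∈ xs → v Data.Fin.Subset.∈ ⋃ (map ⁅_⁆ xs)
∈⇒∈⋃⁅xs⁆ {v = v} (here refl)  = x∈p∪q⁺ (inj₁ (x∈⁅x⁆ v))
∈⇒∈⋃⁅xs⁆         (there v∈xs) = x∈p∪q⁺ (inj₂ (∈⇒∈⋃⁅xs⁆ v∈xs))

opposite-inject₁ : ∀ {n} (i : Fin n) → opposite (inject₁ i) ≡ suc (opposite i)
opposite-inject₁ zero    = refl
opposite-inject₁ (suc i) = cong inject₁ (opposite-inject₁ i)

opposite-injective : ∀ {n} → Injective _≡_ _≡_ (opposite {n})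
opposite-injective {x = i} {j} eq =
  trans (sym (opposite-involutive i)) (trans (cong opposite eq) (opposite-involutive j))

-- Directed paths as lists of vertices.

module _ {n : ℕ} (D : Digraph n) where

  open import Data.List.Membership.DecPropositional (_≟_ {n}) using (_∈?_)

  private
    V = Fin n

  Arc : V → V → Set
  Arc v w = adj D v w ≡ true

  Arc? : ∀ v w → Dec (Arc v w)
  Arc? v w = adj D v w Bool.≟ true

  arc-irrefl : ∀ {v} → ¬ Arc v v
  arc-irrefl {v} a with trans (sym a) (loopless D v)
  ... | ()

  -- Paths are stored backwards, so that they are extended at the head of the list.
  Path : List V → Set
  Path vs = Unique vs × Linked (λ v w → Arc w v) vs

  -- `xs` may contain repetitions, so the comparison goes through the union of the singletons of its
  -- entries.
  outdeg≤length : ∀ {v} (xs : List V) → (∀ w → Arc v w → w ∈ xs) → outdeg D v ≤ length xs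
  outdeg≤length {v} xs N⊆xs = ≤-trans
    (p⊆q⇒∣p∣≤∣q∣ {p = tabulate (adj D v)} λ {w} w∈N → ∈⇒∈⋃⁅xs⁆ (N⊆xs w
      (trans (sym (Vec.lookup∘tabulate (adj D v) w)) (Vec.[]=⇒lookup w∈N))))
    (∣⋃⁅xs⁆∣≤length xs)

  path-length : ∀ {vs} → Path vs → length vs ≤ n
  path-length (vs! , _) = injective⇒≤ (lookup-injective vs!)

  path-++⁻ : ∀ vs {ws} → Path (vs ++ ws) → Path vs × Path ws × Disjoint vs ws
  path-++⁻ vs (u , l) =
    let u₁ , u₂ , d = Unique-++⁻ vs u
        l₁ , l₂     = Linked-++⁻ vs l
    in (u₁ , l₁) , (u₂ , l₂) , d

  path-∷ : ∀ {v} R {x T} → Path (R ++ x ∷ T) → Arc (headOr x R) v → v ∉ R ++ x ∷ T →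
           Path (v ∷ R ++ x ∷ T)
  path-∷ []      (u , l) a v∉ = All.¬Any⇒All¬ _ v∉ ∷ u , a ∷ l
  path-∷ (_ ∷ _) (u , l) a v∉ = All.¬Any⇒All¬ _ v∉ ∷ u , a ∷ l

  path-join : ∀ α M R {x} → Path (α ∷ M) → Path (R ++ [ x ]) → Disjoint (α ∷ M) (R ++ [ x ]) →
              Arc (headOr x R) (lastOr α M) → Path (α ∷ M ++ R ++ [ x ])
  path-join α []      R _             p d a = path-∷ R p a (λ α∈ → d (here refl , α∈))
  path-join α (β ∷ M) R (q ∷ u , l ∷ ls) p d a =
    let u′ , l′ = path-join β M R (u , ls) p (λ (v∈ , w∈) → d (there v∈ , w∈)) a in
    All.¬Any⇒All¬ _ α∉ ∷ u′ , l ∷ l′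
    where
    α∉ : α ∉ β ∷ M ++ R ++ _
    α∉ α∈ with ∈-++⁻ (β ∷ M) α∈
    ... | inj₁ α∈M = All.lookup q α∈M refl
    ... | inj₂ α∈R = d (here refl , α∈R)

  -- The list runs from the end of the path to its start, so `opposite` turns an index along the
  -- path into a position in the list.
  toDiPath : ∀ {y} vs → Path (y ∷ vs) → DiPath D (lastOr y vs) y (length vs)
  toDiPath {y} vs (u , l) = record
    { vtx   = λ i → lookup (y ∷ vs) (opposite i)
    ; inj   = λ eq → opposite-injective (lookup-injective u eq)
    ; start = lookup-last y vs
    ; end   = cong (lookup (y ∷ vs)) (opposite-involutive zero)
    ; arcs  = λ i → subst (λ j → Arc (lookup (y ∷ vs) j) (lookup (y ∷ vs) (opposite (suc i))))
                      (sym (opposite-inject₁ i)) (arcs′ vs l (opposite i))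
    }
    where
    arcs′ : ∀ {y} vs → Linked (λ v w → Arc w v) (y ∷ vs) → (i : Fin (length vs)) →
            Arc (lookup (y ∷ vs) (suc i)) (lookup (y ∷ vs) (inject₁ i))
    arcs′ (_ ∷ _)  (a ∷ _) zero    = a
    arcs′ (_ ∷ vs) (_ ∷ l) (suc i) = arcs′ vs l i

  -- Subdivisions from two paths with common ends.

  twoPaths⇒subdivision : ∀ {k₁ k₂ x y} I J → Path (y ∷ I ++ [ x ]) → Path (y ∷ J ++ [ x ]) →
    Disjoint I J → k₁ ≤ length (I ++ [ x ]) → k₂ ≤ length (J ++ [ x ]) → HasSubdivisionC D k₁ k₂
  twoPaths⇒subdivision {x = x} {y} I J p q I#J k₁≤ k₂≤ =
    x , y , _ , _ , k₁≤ , k₂≤ , P , Q , meet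
    where
    P : DiPath D x y (length (I ++ [ x ]))
    P = subst (λ v → DiPath D v y _) (lastOr-++ y x I) (toDiPath _ p)

    Q : DiPath D x y (length (J ++ [ x ]))
    Q = subst (λ v → DiPath D v y _) (lastOr-++ y x J) (toDiPath _ q)

    -- The end of the equation is kept general, so that matching on `refl` removes the `subst`.
    vtx∈ : ∀ {w} K (eq : lastOr y (K ++ [ x ]) ≡ w) (r : Path (y ∷ K ++ [ x ])) i →
           vtx (subst (λ v → DiPath D v y _) eq (toDiPath _ r)) i ∈ y ∷ K ++ [ x ]
    vtx∈ K refl r i = ∈-lookup (opposite i)

    interior : ∀ {v} K → v ∈ y ∷ K ++ [ x ] → (v ≡ x ⊎ v ≡ y) ⊎ v ∈ K
    interior K (here eq) = inj₁ (inj₂ eq)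
    interior K (there v∈) with ∈-++⁻ K v∈
    ... | inj₁ v∈K       = inj₂ v∈K
    ... | inj₂ (here eq) = inj₁ (inj₁ eq)

    meet : ∀ i j → vtx P i ≡ vtx Q j → vtx P i ≡ x ⊎ vtx P i ≡ y
    meet i j eq
      with interior I (vtx∈ I (lastOr-++ y x I) p i)
         | interior J (subst (_∈ _) (sym eq) (vtx∈ J (lastOr-++ y x J) q j))
    ... | inj₁ e   | _        = e
    ... | inj₂ _   | inj₁ e   = e
    ... | inj₂ v∈I | inj₂ v∈J = ⊥-elim (I#J (v∈I , v∈J))

  -- Both paths run from `x` to `α`: one through `Z` and `u`, the other through `R`, then back to
  -- `lastOr α M` and along `M`. The parts `G` and `T` are discarded.
  fork⇒subdivision : ∀ {k₁ k₂} u Z R x G α M T →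
    Path ((u ∷ Z) ++ x ∷ G ++ α ∷ M ++ T) → Path (R ++ x ∷ G ++ α ∷ M ++ T) →
    Disjoint R (u ∷ Z) → Arc u α → Arc (headOr x R) (lastOr α M) →
    k₁ ≤ length (M ++ R ++ [ x ]) → k₂ ≤ length ((u ∷ Z) ++ [ x ]) → HasSubdivisionC D k₁ k₂
  fork⇒subdivision {k₁} u Z R x G α M T p q R#Z uα zy k₁≤ k₂≤ =
    twoPaths⇒subdivision (M ++ R) (u ∷ Z)
      (subst (λ vs → Path (α ∷ vs)) (sym (++-assoc M R [ x ]))
        (path-join α M R αM Rx (λ (v∈M , v∈R) → Rx#W (v∈R , M⊆W v∈M)) zy))
      (path-join α [] (u ∷ Z) (proj₁ (path-++⁻ [ α ] αM)) Zx
        (λ { (here refl , v∈Z) → Zx#W (v∈Z , M⊆W (here refl)) }) uα)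
      I#Z (subst (λ vs → k₁ ≤ length vs) (sym (++-assoc M R [ x ])) k₁≤) k₂≤
    where
    W : List V
    W = G ++ (α ∷ M) ++ T

    unsnoc : ∀ K → Path (K ++ x ∷ W) → Path (K ++ [ x ]) × Path W × Disjoint (K ++ [ x ]) W
    unsnoc K r = path-++⁻ (K ++ [ x ]) (subst Path (sym (++-assoc K [ x ] W)) r)

    Rx : Path (R ++ [ x ])
    Rx = proj₁ (unsnoc R q)

    Rx#W : Disjoint (R ++ [ x ]) W
    Rx#W = proj₂ (proj₂ (unsnoc R q))

    Zx : Path (u ∷ Z ++ [ x ])
    Zx = proj₁ (unsnoc (u ∷ Z) p)

    Zx#W : Disjoint (u ∷ Z ++ [ x ]) W
    Zx#W = proj₂ (proj₂ (unsnoc (u ∷ Z) p))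

    αM : Path (α ∷ M)
    αM = proj₁ (path-++⁻ (α ∷ M) (proj₁ (proj₂ (path-++⁻ G (proj₁ (proj₂ (unsnoc R q)))))))

    M⊆W : ∀ {v} → v ∈ α ∷ M → v ∈ W
    M⊆W = ∈-++⁺ʳ G ∘ ∈-++⁺ˡ

    I#Z : Disjoint (M ++ R) (u ∷ Z)
    I#Z (v∈I , v∈Z) with ∈-++⁻ M v∈I
    ... | inj₁ v∈M = Zx#W (∈-++⁺ˡ v∈Z , M⊆W (there v∈M))
    ... | inj₂ v∈R = R#Z (v∈R , v∈Z)

  -- Restores the invariant of `search` for a new end `w`, with `Z` in the role of `E`; `w` itself
  -- drops out because there are no loops.
  arcs-avoiding : ∀ {w P Z F B} → P ≡ w ∷ F ++ B → (∀ v → Arc w v → v ∈ P ++ Z) →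
                  All (¬_ ∘ Arc w) B → ∀ v → Arc w v → v ∈ Z ++ F
  arcs-avoiding {w} {Z = Z} {F} {B} refl N⊆ none v wv with ∈-++⁻ (w ∷ F ++ B) (N⊆ v wv)
  ... | inj₂ v∈Z         = ∈-++⁺ˡ v∈Z
  ... | inj₁ (here refl) = contradiction wv arc-irrefl
  ... | inj₁ (there v∈) with ∈-++⁻ F v∈
  ...   | inj₁ v∈F = ∈-++⁺ʳ Z v∈F
  ...   | inj₂ v∈B = contradiction wv (All.lookup none v∈B)

  -- Greedy extension of a path outside a forbidden set.

  MaximalExtension : List V → V → List V → Set
  MaximalExtension Z x T = ∃[ R ] (Path (R ++ x ∷ T) × Disjoint R Z ×
    (∀ v → Arc (headOr x R) v → v ∈ (R ++ x ∷ T) ++ Z))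

  extend : ∀ Z x T → Path (x ∷ T) → MaximalExtension Z x T
  extend Z x T p = go n [] p (λ ()) (m≤m+n n _)
    where
    -- `k` bounds the number of further extensions, since a path has at most `n` vertices.
    go : ∀ k R → Path (R ++ x ∷ T) → Disjoint R Z → n ≤ k + length (R ++ x ∷ T) →
         MaximalExtension Z x T
    go k R p R#Z n≤ with any? (λ v → Arc? (headOr x R) v ×-dec ¬? (v ∈? (R ++ x ∷ T) ++ Z))
    ... | no ¬v = R , p , R#Z , λ v a → decidable-stable (v ∈? _) (λ v∉ → ¬v (v , a , v∉))
    ... | yes (v , a , v∉) = step k n≤
      where
      p′ : Path (v ∷ R ++ x ∷ T)
      p′ = path-∷ R p a (v∉ ∘ ∈-++⁺ˡ)

      step : ∀ k → n ≤ k + length (R ++ x ∷ T) → MaximalExtension Z x T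
      step zero    n≤ = contradiction (≤-trans (path-length p′) n≤) (<-irrefl refl)
      step (suc k) n≤ = go k (v ∷ R) p′
        (λ { (here refl , v∈Z) → v∉ (∈-++⁺ʳ (R ++ x ∷ T) v∈Z) ; (there w∈R , w∈Z) → R#Z (w∈R , w∈Z) })
        (≤-trans n≤ (≤-reflexive (sym (+-suc k _))))

-- With k₂ = 2 + c the hypothesis k₁ + 3k₂ - 5 on the out-degrees reads k₁ + (3c + 1).
degree-bound : ∀ a c m → a + suc (c + c + c) ≤ suc c + (c + m) → a ≤ m
degree-bound a c m h = +-cancelʳ-≤ (suc (c + c)) a m (begin
  a + suc (c + c)     ≤⟨ +-monoʳ-≤ a (s≤s (m≤m+n (c + c) c)) ⟩
  a + suc (c + c + c) ≤⟨ h ⟩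
  suc c + (c + m)     ≡⟨ rearrange c m ⟩
  m + suc (c + c)     ∎)
  where
  open ≤-Reasoning
  rearrange : ∀ c m → suc c + (c + m) ≡ m + suc (c + c)
  rearrange = solve-∀

-- Degree counting and the extremal search.

module _ {n : ℕ} (D : Digraph n) (a c : ℕ) (2≤a : 2 ≤ a)
         (δ : MinOutDegAtLeast D (a + suc (c + c + c))) where

  private
    V = Fin n

  -- The summand `c` makes room for the segment `Z`; `m` bounds the remaining candidates outside
  -- `E`.
  degree-count : ∀ {u} (E xs : List V) m → length E ≤ suc c → length xs ≤ c + m →
                 (∀ v → Arc D u v → v ∈ E ++ xs) → a ≤ m
  degree-count {u} E xs m |E|≤ |xs|≤ N⊆ = degree-bound a c m (begin
    a + suc (c + c + c)   ≤⟨ δ u ⟩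
    outdeg D u            ≤⟨ outdeg≤length D (E ++ xs) N⊆ ⟩
    length (E ++ xs)      ≡⟨ length-++ E ⟩
    length E + length xs  ≤⟨ +-mono-≤ |E|≤ |xs|≤ ⟩
    suc c + (c + m)       ∎)
    where open ≤-Reasoning

  Goal : Set
  Goal = HasSubdivisionC D a (2 + c)

  record Split (E F : List V) (u : V) : Set where
    constructor split
    field
      {Z G M} : List V
      {x α}   : V
      F≡      : F ≡ Z ++ x ∷ G ++ α ∷ M
      |Z|≡    : length Z ≡ c
      u→α     : Arc D u α
      a≤|M|+2 : a ≤ 2 + length M

  -- With `α` the first out-neighbour of `u` beyond `x` in the list, none lies in `G`. All of them
  -- are then in `E`, in `Z` or in `x ∷ α ∷ M`, which forces `M` to be long.
  splitPath : ∀ E F u → length E ≤ suc c → (∀ v → Arc D u v → v ∈ E ++ F) → Split E F u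
  splitPath E F u |E|≤ N⊆ with splitAt-< c F c<|F|
    where
    c<|F| : c < length F
    -- A shorter `F` would give `a ≤ 0`.
    c<|F| = ≰⇒> λ |F|≤c → contradiction
      (≤-trans 2≤a (degree-count E F 0 |E|≤ (≤-trans |F|≤c (m≤m+n c 0)) N⊆)) λ ()
  ... | Z , x , F′ , refl , |Z|≡ with splitFirst (Arc? D u) F′
  -- Here only `x` could be an out-neighbour outside `E` and `Z`, giving `a ≤ 1`.
  ...   | inj₂ none = contradiction (≤-trans 2≤a (degree-count E (Z ++ [ x ]) 1 |E|≤
            (≤-reflexive (trans (length-++ Z) (cong (_+ 1) |Z|≡))) N⊆′)) λ { (s≤s ()) }
    where
    N⊆′ : ∀ v → Arc D u v → v ∈ E ++ Z ++ [ x ]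
    N⊆′ v uv with ∈-++⁻ E (N⊆ v uv)
    ... | inj₁ v∈E = ∈-++⁺ˡ v∈E
    ... | inj₂ v∈F with ∈-++⁻ Z v∈F
    ...   | inj₁ v∈Z         = ∈-++⁺ʳ E (∈-++⁺ˡ v∈Z)
    ...   | inj₂ (here refl) = ∈-++⁺ʳ E (∈-++⁺ʳ Z (here refl))
    ...   | inj₂ (there v∈)  = contradiction uv (All.lookup none v∈)
  ...   | inj₁ (G , α , M , refl , none , uα) = split {Z = Z} {G} {M} {x} {α} refl |Z|≡ uα
            (degree-count E (Z ++ x ∷ α ∷ M) (2 + length M) |E|≤
              (≤-reflexive (trans (length-++ Z) (cong (_+ (2 + length M)) |Z|≡))) N⊆′)
    where
    N⊆′ : ∀ v → Arc D u v → v ∈ E ++ Z ++ x ∷ α ∷ M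
    N⊆′ v uv with ∈-++⁻ E (N⊆ v uv)
    ... | inj₁ v∈E = ∈-++⁺ˡ v∈E
    ... | inj₂ v∈F with ∈-++⁻ Z v∈F
    ...   | inj₁ v∈Z         = ∈-++⁺ʳ E (∈-++⁺ˡ v∈Z)
    ...   | inj₂ (here refl) = ∈-++⁺ʳ E (∈-++⁺ʳ Z (here refl))
    ...   | inj₂ (there v∈) with ∈-++⁻ G v∈
    ...     | inj₁ v∈G = contradiction uv (All.lookup none v∈G)
    ...     | inj₂ v∈M = ∈-++⁺ʳ E (∈-++⁺ʳ Z (there v∈M))

  -- The extremal choice, as a lexicographic recursion on (n - |B|, |F|): B is an initial segment of
  -- the path known to contain no out-neighbour of u.
  search : ∀ k m u E F B → n ≤ k + length B → length F ≤ m → length E ≤ suc c →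
           Path D (u ∷ F ++ B) → (∀ v → Arc D u v → v ∈ E ++ F) → Goal
  search k m u E F B n≤ |F|≤ |E|≤ p N⊆ with splitPath E F u |E|≤ N⊆
  ... | split {Z} {G} {M} {x} {α} refl |Z|≡ uα a≤ = byEnd (extend D (u ∷ Z) x S S-path)
    where
    S : List V
    S = G ++ α ∷ M ++ B

    assoc₁ : (G ++ α ∷ M) ++ B ≡ S
    assoc₁ = ++-assoc G (α ∷ M) B

    p′ : Path D ((u ∷ Z) ++ x ∷ S)
    p′ = subst (λ vs → Path D (u ∷ vs))
           (trans (++-assoc Z (x ∷ G ++ α ∷ M) B) (cong (λ vs → Z ++ x ∷ vs) assoc₁)) p

    S-path : Path D (x ∷ S)
    S-path = proj₁ (proj₂ (path-++⁻ D (u ∷ Z) p′))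

    |uZ|≡ : length (u ∷ Z) ≡ suc c
    |uZ|≡ = cong suc |Z|≡

    b≤ : 2 + c ≤ length ((u ∷ Z) ++ [ x ])
    b≤ = ≤-reflexive (sym (trans (length-++ (u ∷ Z)) (trans (cong (_+ 1) |uZ|≡) (+-comm (suc c) 1))))

    shorter : ∀ {m} → length (Z ++ x ∷ G ++ α ∷ M) ≤ suc m → length (G ++ α ∷ M) ≤ m
    shorter h = ≤-pred (≤-trans (length-++-≤ʳ (x ∷ G ++ α ∷ M) {Z}) h)

    nonempty : ∀ {m} → length (Z ++ x ∷ G ++ α ∷ M) ≤ m → 0 < m
    nonempty h = ≤-trans (s≤s z≤n) (≤-trans (length-++-≤ʳ (x ∷ G ++ α ∷ M) {Z}) h)

    atLeast : ∀ {L} → 2 ≤ length L → a ≤ length (M ++ L)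
    atLeast {L} 2≤ = ≤-trans a≤ (≤-trans (≤-reflexive (+-comm 2 (length M)))
      (≤-trans (+-monoʳ-≤ (length M) 2≤) (≤-reflexive (sym (length-++ M)))))

    byEnd : MaximalExtension D (u ∷ Z) x S → Goal
    byEnd (R , q , R#Z , N⊆′) with splitFirst (Arc? D (headOr x R)) B
    -- The second path contains all of `M`; `y` and `x` make up for the 2 in `a ≤ 2 + length M`.
    ... | inj₁ (B₁ , y , B₂ , refl , _ , zy) =
      fork⇒subdivision D u Z R x G α M′ B₂ (subst (λ vs → Path D (u ∷ Z ++ x ∷ G ++ α ∷ vs)) eq p′)
        (subst (λ vs → Path D (R ++ x ∷ G ++ α ∷ vs)) eq q) R#Z uα
        (subst (Arc D _) (sym last≡) zy) a≤′ b≤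
      where
      M′ : List V
      M′ = (M ++ B₁) ++ [ y ]

      eq : M ++ B₁ ++ y ∷ B₂ ≡ M′ ++ B₂
      eq = trans (sym (++-assoc M B₁ (y ∷ B₂))) (sym (++-assoc (M ++ B₁) [ y ] B₂))

      last≡ : lastOr α M′ ≡ y
      last≡ = lastOr-++ α y (M ++ B₁)

      a≤′ : a ≤ length (M′ ++ R ++ [ x ])
      a≤′ = subst (λ vs → a ≤ length vs)
        (sym (trans (++-assoc (M ++ B₁) [ y ] (R ++ [ x ])) (++-assoc M B₁ (y ∷ R ++ [ x ]))))
        (atLeast (≤-trans (s≤s (length-++-≤ʳ [ x ] {R})) (length-++-≤ʳ (y ∷ R ++ [ x ]) {B₁})))
    -- Here `x` cannot be extended: the path is cut back to `x`, which shortens `F` and keeps `B`.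
    byEnd ([] , q , R#Z , N⊆′) | inj₂ none = shorten m |F|≤
      where
      shorten : ∀ m → length (Z ++ x ∷ G ++ α ∷ M) ≤ m → Goal
      shorten zero    h = contradiction (nonempty h) λ ()
      shorten (suc m) h = search k m x (u ∷ Z) (G ++ α ∷ M) B n≤ (shorter h) (≤-reflexive |uZ|≡)
        (subst (λ vs → Path D (x ∷ vs)) (sym assoc₁) q)
        (arcs-avoiding D (cong (x ∷_) (sym assoc₁)) N⊆′ none)
    byEnd (z ∷ R , q , R#Z , N⊆′) | inj₂ none with Arc? D z (lastOr α M) | init-last α M
    -- `lastOr α M` comes right after `B` on the path and serves as `y`; now `z` and `x` make up for
    -- the 2.
    ... | yes ze | _      = fork⇒subdivision D u Z (z ∷ R) x G α M B p′ q R#Z uα ze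
          (atLeast (s≤s (length-++-≤ʳ [ x ] {R}))) b≤
    -- This vertex can join `B`. The new `F′` may be longer than `F`, as the first measure drops.
    ... | no ¬ze | H , eq = advance k n≤
      where
      e : V
      e = lastOr α M

      F′ : List V
      F′ = R ++ x ∷ G ++ H

      F′-eq : z ∷ R ++ x ∷ S ≡ z ∷ F′ ++ e ∷ B
      F′-eq = cong (z ∷_) (trans (cong (λ vs → R ++ x ∷ vs) GS)
                (sym (++-assoc R (x ∷ G ++ H) (e ∷ B))))
        where
        GS : S ≡ (G ++ H) ++ e ∷ B
        GS = trans (cong (λ vs → G ++ vs ++ B) eq)
               (trans (cong (G ++_) (++-assoc H [ e ] B)) (sym (++-assoc G H (e ∷ B))))

      advance : ∀ k → n ≤ k + length B → Goal
      -- The path has more vertices than `B`, so `B` has fewer than `n`.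
      advance zero    n≤ = contradiction
        (≤-trans (s≤s (length-++-≤ʳ B {Z ++ x ∷ G ++ α ∷ M})) (≤-trans (path-length D p) n≤))
        (<-irrefl refl)
      advance (suc k) n≤ = search k (length F′) z (u ∷ Z) F′ (e ∷ B)
        (≤-trans n≤ (≤-reflexive (sym (+-suc k (length B))))) ≤-refl (≤-reflexive |uZ|≡)
        (subst (Path D) F′-eq q) (arcs-avoiding D F′-eq N⊆′ (¬ze ∷ none))

theorem1p8 : (k₁ k₂ : ℕ) → 2 ≤ k₂ → k₂ ≤ k₁ →
    (n : ℕ) → 0 < n → (D : Digraph n) →
    MinOutDegAtLeast D (k₁ + 3 * k₂ ∸ 5) →
    HasSubdivisionC D k₁ k₂
theorem1p8 _  (suc zero) (s≤s ())
theorem1p8 k₁ (suc (suc c)) _ k₂≤k₁ (suc n) _ D δ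
  -- A greedy path with nothing to avoid contains all out-neighbours of its end, so `E` and `B`
  -- start empty.
  with extend D [] zero [] ([] ∷ [] , [-])
... | R , p , _ , N⊆ = launch R p N⊆
  where
  -- With 5 as the leading summand, the truncated subtraction reduces by computation.
  rearrange : ∀ a c → a + 3 * suc (suc c) ≡ 5 + (a + suc (c + c + c))
  rearrange = solve-∀

  δ′ : MinOutDegAtLeast D (k₁ + suc (c + c + c))
  δ′ = subst (MinOutDegAtLeast D) (cong (_∸ 5) (rearrange k₁ c)) δ

  go : ∀ {P} u F → P ≡ u ∷ F → Path D P → (∀ v → Arc D u v → v ∈ P ++ []) →
       HasSubdivisionC D k₁ (2 + c)
  go u F refl p N⊆ = search D k₁ c (≤-trans (s≤s (s≤s z≤n)) k₂≤k₁) δ′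
    (suc n) (length F) u [] F [] (m≤m+n (suc n) 0) ≤-refl z≤n
    (subst (λ vs → Path D (u ∷ vs)) (sym (++-identityʳ F)) p)
    (arcs-avoiding D (cong (u ∷_) (sym (++-identityʳ F))) N⊆ [])

  launch : ∀ R → Path D (R ++ [ zero ]) → (∀ v → Arc D (headOr zero R) v → v ∈ (R ++ [ zero ]) ++ []) →
          HasSubdivisionC D k₁ (2 + c)
  launch []      = go zero [] refl
  launch (u ∷ R) = go u (R ++ [ zero ]) refl
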